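{- Let $\mathbb{F}$ be a field and let $f\in\mathbb{F}[x_1,\ldots,x_n]$ be such that $f=\det(M)$ for some matrix $M$ with entries in $\{x_1,\ldots,x_n\}\cup\mathbb{F}$ in which each variable occurs in at most one position. Suppose $f$ is $n$-full, $(n-1)$-empty and $(n-2)$-empty. Then $f$ is not $k$-full for any $k$ with $\lfloor\frac{n-1}{2}\rfloor\le k<n$.
   Context: For a polynomial $f\in\mathbb{F}[x_1,\ldots,x_n]$ and an integer $k$, $f$ is called $k$-full if every multilinear monomial of degree $k$ (product of $k$ distinct variables among $x_1,\ldots,x_n$) has nonzero coefficient in $f$, and $k$-empty if no monomial of degree $k$ has nonzero coefficient in $f$. -}

module Defs where

open import Level using (Level; suc; _⊔_)
open import Algebra.Bundles using (CommutativeRing)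
open import Data.Nat as ℕ using (ℕ; zero)
open import Data.Nat.Properties using () renaming (_≟_ to _≟ℕ_)
open import Data.Fin as Fin using (Fin; punchIn)
open import Data.Fin.Subset using (Subset; ∣_∣; inside)
open import Data.Bool using (true; false)
open import Data.Vec as Vec using (Vec)
open import Data.Vec.Properties using (≡-dec)
open import Data.List as List using (List; []; _∷_; _++_)
open import Data.Product using (Σ; _×_; _,_)
open import Data.Sum using (_⊎_; inj₁; inj₂)
open import Relation.Nullary using (¬_; yes; no)
open import Relation.Binary.PropositionalEquality using (_≡_)

record Field (c ℓ : Level) : Set (suc (c ⊔ ℓ)) where
  field
    commutativeRing : CommutativeRing c ℓ
  open CommutativeRing commutativeRing public
  field
    0≉1     : ¬ (0# ≈ 1#)
    inverse : ∀ x → ¬ (x ≈ 0#) → Σ Carrier (λ y → (x * y) ≈ 1#)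

module Poly {c ℓ : Level} (F : Field c ℓ) (n : ℕ) where
  open Field F

  Monomial : Set
  Monomial = Vec ℕ n

  -- A polynomial in F[x₁,…,xₙ], represented as a formal finite sum of
  -- terms  c · x^e  (a list of (coefficient, exponent) pairs).
  Polynomial : Set c
  Polynomial = List (Carrier × Monomial)

  degree : Monomial → ℕ
  degree e = Vec.foldr _ ℕ._+_ 0 e

  coeff : Polynomial → Monomial → Carrier
  coeff [] α = 0#
  coeff ((a , e) ∷ p) α with ≡-dec _≟ℕ_ e α
  ... | yes _ = a + coeff p α
  ... | no  _ = coeff p α

  const : Carrier → Polynomial
  const a = (a , Vec.replicate n 0) ∷ []

  var : Fin n → Polynomial
  var i = (1# , Vec.updateAt (Vec.replicate n 0) i (λ _ → 1)) ∷ []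

  _⊕_ : Polynomial → Polynomial → Polynomial
  p ⊕ q = p ++ q

  neg : Polynomial → Polynomial
  neg = List.map (λ { (a , e) → (- a , e) })

  _⊗_ : Polynomial → Polynomial → Polynomial
  p ⊗ q = List.concatMap (λ { (a , e) → List.map (λ { (b , e') → (a * b , Vec.zipWith ℕ._+_ e e') }) q }) p

  Entry : Set c
  Entry = Fin n ⊎ Carrier

  entry : Entry → Polynomial
  entry (inj₁ i) = var i
  entry (inj₂ a) = const a

  ReadOnce : ∀ {m} → (Fin m → Fin m → Entry) → Set c
  ReadOnce {m} M = ∀ (i j i' j' : Fin m) (v : Fin n) →
    M i j ≡ inj₁ v → M i' j' ≡ inj₁ v → (i ≡ i') × (j ≡ j')

  det : ∀ {m} → (Fin m → Fin m → Polynomial) → Polynomial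
  det {zero} A = const 1#
  det {ℕ.suc m} A = go 0 (List.allFin (ℕ.suc m))
    where
    minor : Fin (ℕ.suc m) → Fin m → Fin m → Polynomial
    minor j r s = A (Fin.suc r) (punchIn j s)
    go : ℕ → List (Fin (ℕ.suc m)) → Polynomial
    go k [] = []
    go k (j ∷ js) = sgn k (A Fin.zero j ⊗ det (minor j)) ⊕ go (ℕ.suc k) js
      where
      sgn : ℕ → Polynomial → Polynomial
      sgn zero p = p
      sgn (ℕ.suc zero) p = neg p
      sgn (ℕ.suc (ℕ.suc t)) p = sgn t p

  indicator : Subset n → Monomial
  indicator S = Vec.map (λ { true → 1 ; false → 0 }) S

  Full : ℕ → Polynomial → Set ℓ
  Full k f = ∀ (S : Subset n) → ∣ S ∣ ≡ k → ¬ (coeff f (indicator S) ≈ 0#)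

  Empty : ℕ → Polynomial → Set ℓ
  Empty k f = ∀ (α : Monomial) → degree α ≡ k → coeff f α ≈ 0#

{-# OPTIONS --safe #-}
-- Fullness in degree n puts the variables in distinct rows, so the coefficient
-- of x^S in f is the determinant of the scalar matrix whose row for x_w is a unit
-- vector (w ∈ S) or the constant part of that row (w ∉ S).  When S contains all the
-- variables this matrix, N, is invertible.  Let A v w be the coordinate of the constant part of
-- the row of v along the row of w in N; the coefficient of x^S is then det N times
-- the principal minor of A on the complement of S.  Emptiness in degrees n - 1
-- and n - 2 says A v v = 0 and A v w · A w v = 0, so by double counting some row v of A
-- has more than n / 2 zeros, including the diagonal one.  Choosing the complement
-- of S among them, with v inside, kills the minor.
-- Equality in F is not decidable, but the goal is a negation, so the finitely many
-- case distinctions needed are available under a double negation.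
module Submission where

open import Defs
open import Level using (Level; _⊔_)
open import Data.Bool as Bool using (Bool; true; false; not)
open import Data.Bool.Properties using (¬-not)
open import Data.Empty using (⊥)
open import Data.Nat as ℕ using (ℕ; zero; suc; z≤n; s≤s; _∸_; _/_; _≤_; _<_)
import Data.Nat.Properties as ℕₚ
open import Data.Nat.Tactic.RingSolver using (solve-∀)
open import Data.Fin as Fin using (Fin; zero; suc; punchIn; toℕ; inject₁)
open import Data.Fin.Properties using (suc-injective; toℕ-inject₁; _≟_; any?; sequence)
open import Data.Fin.Subset using (Subset; ∣_∣; ⊤; ∁)
open import Data.Fin.Subset.Properties using (∣⊤∣≡n; ∣∁p∣≡n∸∣p∣)
open import Data.List as List using (List; []; _∷_; _++_)
open import Data.Maybe as Maybe using (Maybe; just; nothing; maybe)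
open import Data.Maybe.Properties using (just-injective)
open import Data.Product using (_×_; _,_; ∃; proj₁; proj₂)
open import Data.Sum using (_⊎_; inj₁; inj₂)
open import Data.Vec as Vec using (Vec; lookup; tabulate; zipWith; replicate; _[_]≔_; []; _∷_)
open import Data.Vec.Functional using (insertAt; updateAt)
open import Data.Vec.Functional.Properties
  using (insertAt-lookup; insertAt-punchIn; updateAt-updates; updateAt-minimal)
open import Data.Vec.Properties
  using (≡-dec; map-cong; lookup-map; lookup-replicate; lookup∘tabulate; lookup∘update; lookup∘update′)
open import Effect.Monad using (RawMonad)
open import Function using (_∘_)
open import Relation.Nullary using (¬_; Dec; yes; no; does; contradiction)
open import Relation.Nullary.Decidable using (map′; dec⇒maybe; dec-true; _×-dec_; ¬¬-excluded-middle)
open import Relation.Nullary.Negation using (¬¬-Monad)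
open import Relation.Binary.PropositionalEquality as ≡ using (_≡_; _≢_)

-- Double negation is applicative, so it commutes with finite products. Finitely many undecidable
-- alternatives can thus be settled together when the goal is a negation.
¬¬-∀ : ∀ {a n} {P : Fin n → Set a} → (∀ i → ¬ ¬ P i) → ¬ ¬ (∀ i → P i)
¬¬-∀ = sequence (RawMonad.rawApplicative ¬¬-Monad)

bit : Bool → ℕ
bit true  = 1
bit false = 0

-- Counting: a large neighbourhood, subsets of prescribed size, and the arithmetic of the bound on
-- k.

module Counting where
  open import Data.Nat using (_+_; _*_; _%_; _≤?_; _<?_)
  open import Data.Nat.DivMod using (m≡m%n+[m/n]*n; m%n<n)
  open import Data.Nat.Properties
    using (≤-refl; ≤-trans; ≤-reflexive; ≤-antisym; ≮⇒≥; ≰⇒>; +-mono-≤; +-monoˡ-≤; +-cancelˡ-≤; *-monoˡ-≤;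
           *-suc; *-identityʳ; m≤n+m; m∸n+n≡m; <⇒≤; n≮n; module ≤-Reasoning; +-0-commutativeMonoid)
  open import Algebra.Properties.CommutativeMonoid.Sum +-0-commutativeMonoid
    using (sum; sum-syntax; sum-cong-≗; ∑-distrib-+; ∑-comm)

  sum-≤ : ∀ {n} {f : Fin n → ℕ} {a} → (∀ i → f i ≤ a) → sum f ≤ n * a
  sum-≤ {zero}  f≤a = z≤n
  sum-≤ {suc n} f≤a = +-mono-≤ (f≤a zero) (sum-≤ (f≤a ∘ suc))

  sum-≥ : ∀ {n} {f : Fin n → ℕ} {a} → (∀ i → a ≤ f i) → n * a ≤ sum f
  sum-≥ {zero}  a≤f = z≤n
  sum-≥ {suc n} a≤f = +-mono-≤ (a≤f zero) (sum-≥ (a≤f ∘ suc))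

  sum-positive : ∀ {n} {f : Fin n → ℕ} v → (∀ i → 1 ≤ f i) → 2 ≤ f v → suc n ≤ sum f
  sum-positive {suc n} {f} zero 1≤f 2≤fv =
    +-mono-≤ 2≤fv (≤-trans (≤-reflexive (≡.sym (*-identityʳ n))) (sum-≥ (1≤f ∘ suc)))
  sum-positive {suc n} (suc v) 1≤f 2≤fv = +-mono-≤ (1≤f zero) (sum-positive v (1≤f ∘ suc) 2≤fv)

  ∣tabulate∣ : ∀ {n} (f : Fin n → Bool) → ∣ tabulate f ∣ ≡ sum (bit ∘ f)
  ∣tabulate∣ {zero}  f = ≡.refl
  ∣tabulate∣ {suc n} f with f zero
  ... | true  = ≡.cong suc (∣tabulate∣ (f ∘ suc))
  ... | false = ∣tabulate∣ (f ∘ suc)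

  -- Double counting of the pairs (v , w) with E v w.
  large-neighbourhood : ∀ {n} (E : Fin n → Fin n → Bool) → 0 < n → (∀ v → E v v ≡ true) →
    (∀ v w → v ≢ w → E v w ≡ true ⊎ E w v ≡ true) →
    ∃ λ v → n < ∣ tabulate (E v) ∣ + ∣ tabulate (E v) ∣
  large-neighbourhood {n} E 0<n loop total
    with any? (λ v → n <? ∣ tabulate (E v) ∣ + ∣ tabulate (E v) ∣)
  ... | yes large = large
  ... | no  small = contradiction n*[1+n]≤n*n (too-small 0<n)
    where
    open ≤-Reasoning
    too-small : ∀ {n} → 0 < n → ¬ (n * suc n ≤ n * n)
    too-small {suc n} _ le = n≮n (suc n * suc n) (begin-strict
      suc n * suc n            <⟨ s≤s (m≤n+m _ n) ⟩
      suc n + suc n * suc n    ≡⟨ *-suc (suc n) (suc n) ⟨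
      suc n * suc (suc n)      ≤⟨ le ⟩
      suc n * suc n            ∎)
    e : Fin n → Fin n → ℕ
    e v w = bit (E v w)
    pair : ∀ v w → 1 ≤ e v w + e w v
    pair v w with v ≟ w
    ... | yes ≡.refl rewrite loop v = s≤s z≤n
    ... | no  v≢w with total v w v≢w
    ...   | inj₁ p rewrite p = s≤s z≤n
    ...   | inj₂ p rewrite p = m≤n+m 1 (e v w)
    diagonal : ∀ v → 2 ≤ e v v + e v v
    diagonal v rewrite loop v = ≤-refl
    -- For fixed v the sums `e v w + e w v` are all positive, and the diagonal one is 2, so they add
    -- up to at least n + 1. Over all v they count E twice, hence at most n * n if every
    -- neighbourhood has at most n / 2 elements.
    n*[1+n]≤n*n : n * suc n ≤ n * n
    n*[1+n]≤n*n = begin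
      n * suc n
        ≤⟨ sum-≥ (λ v → sum-positive v (pair v) (diagonal v)) ⟩
      ∑[ v < n ] ∑[ w < n ] (e v w + e w v)
        ≡⟨ sum-cong-≗ (λ v → ∑-distrib-+ (e v) (λ w → e w v)) ⟩
      ∑[ v < n ] (sum (e v) + ∑[ w < n ] e w v)
        ≡⟨ ∑-distrib-+ (λ v → sum (e v)) (λ v → ∑[ w < n ] e w v) ⟩
      ∑[ v < n ] sum (e v) + ∑[ v < n ] ∑[ w < n ] e w v
        ≡⟨ ≡.cong (∑[ v < n ] sum (e v) +_) (∑-comm (λ v w → e w v)) ⟩
      ∑[ v < n ] sum (e v) + ∑[ v < n ] sum (e v)
        ≡⟨ ∑-distrib-+ (λ v → sum (e v)) (λ v → sum (e v)) ⟨
      ∑[ v < n ] (sum (e v) + sum (e v))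
        ≤⟨ sum-≤ (λ v → ≤-trans
             (≤-reflexive (≡.cong₂ _+_ (≡.sym (∣tabulate∣ (E v))) (≡.sym (∣tabulate∣ (E v)))))
             (≮⇒≥ λ lt → small (v , lt))) ⟩
      n * n ∎

  _⊑_ : ∀ {n} → Subset n → Subset n → Set
  T ⊑ P = ∀ w → lookup T w ≡ true → lookup P w ≡ true

  ∷-⊑ : ∀ {n b b′} {T P : Subset n} → (b ≡ true → b′ ≡ true) → T ⊑ P → (b ∷ T) ⊑ (b′ ∷ P)
  ∷-⊑ b≤b′ T⊑P zero    = b≤b′
  ∷-⊑ b≤b′ T⊑P (suc w) = T⊑P w

  subset-of-size : ∀ {n} (P : Subset n) s → s ≤ ∣ P ∣ → ∃ λ T → ∣ T ∣ ≡ s × T ⊑ P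
  subset-of-size []          zero    _ = [] , ≡.refl , λ ()
  subset-of-size (false ∷ P) s s≤ with subset-of-size P s s≤
  ... | T , ∣T∣≡s , T⊑P = false ∷ T , ∣T∣≡s , ∷-⊑ (λ ()) T⊑P
  subset-of-size (true ∷ P)  zero _ with subset-of-size P zero z≤n
  ... | T , ∣T∣≡s , T⊑P = false ∷ T , ∣T∣≡s , ∷-⊑ (λ ()) T⊑P
  subset-of-size (true ∷ P)  (suc s) (s≤s s≤) with subset-of-size P s s≤
  ... | T , ∣T∣≡s , T⊑P = true ∷ T , ≡.cong suc ∣T∣≡s , ∷-⊑ (λ p → p) T⊑P

  -- An element in front of v is left out while the rest still has s elements. Once the rest is too
  -- small, the whole set has exactly s elements and is taken.
  subset-of-size-∋ : ∀ {n} (P : Subset n) v s → lookup P v ≡ true → 0 < s → s ≤ ∣ P ∣ →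
    ∃ λ T → ∣ T ∣ ≡ s × lookup T v ≡ true × T ⊑ P
  subset-of-size-∋ (true ∷ P) zero (suc s) _ _ (s≤s s≤) with subset-of-size P s s≤
  ... | T , ∣T∣≡s , T⊑P = true ∷ T , ≡.cong suc ∣T∣≡s , ≡.refl , ∷-⊑ (λ p → p) T⊑P
  subset-of-size-∋ (b ∷ P) (suc v) s v∈P 0<s s≤ with s ≤? ∣ P ∣
  ... | yes s≤∣P∣ with subset-of-size-∋ P v s v∈P 0<s s≤∣P∣
  ...   | T , ∣T∣≡s , v∈T , T⊑P = false ∷ T , ∣T∣≡s , v∈T , ∷-⊑ (λ ()) T⊑P
  subset-of-size-∋ (false ∷ P) (suc v) s v∈P 0<s s≤ | no s≰∣P∣ = contradiction s≤ s≰∣P∣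
  subset-of-size-∋ (true ∷ P)  (suc v) s v∈P 0<s s≤ | no s≰∣P∣ =
    true ∷ P , ≤-antisym (≰⇒> s≰∣P∣) s≤ , v∈P , λ w p → p

  ∣remove∣ : ∀ {n} (S : Subset n) v → lookup S v ≡ true → suc ∣ S [ v ]≔ false ∣ ≡ ∣ S ∣
  ∣remove∣ (true ∷ S)  zero    _   = ≡.refl
  ∣remove∣ (false ∷ S) (suc v) v∈S = ∣remove∣ S v v∈S
  ∣remove∣ (true ∷ S)  (suc v) v∈S = ≡.cong suc (∣remove∣ S v v∈S)

  -- The lower bound on k gives n ≤ 2k + 2, whereas n - k > d together with 2d > n would force n ≥
  -- 2k + 3.
  complement-size-≤ : ∀ n k d → (n ∸ 1) / 2 ≤ k → k < n → n < d + d → n ∸ k ≤ d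
  complement-size-≤ n@(suc n′) k d half≤k k<n n<2d with n ∸ k ≤? d
  ... | yes s≤d = s≤d
  ... | no  s≰d = contradiction 3+2k≤2+2k (n≮n _)
    where
    open ≤-Reasoning
    s = n ∸ k
    n≤2+2k : n ≤ 2 + k * 2
    n≤2+2k = begin
      suc n′                         ≡⟨ ≡.cong suc (m≡m%n+[m/n]*n n′ 2) ⟩
      suc (n′ % 2 + n′ / 2 * 2)      ≤⟨ +-mono-≤ (m%n<n n′ 2) (*-monoˡ-≤ 2 half≤k) ⟩
      2 + k * 2                      ∎
    3+2k≤2+2k : 3 + k * 2 ≤ 2 + k * 2
    3+2k≤2+2k = ≤-trans (+-cancelˡ-≤ n (3 + k * 2) n (begin
      n + (3 + k * 2)            ≡⟨ rearrange₁ n k ⟩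
      (suc n + 2) + k * 2        ≤⟨ +-monoˡ-≤ (k * 2) (+-monoˡ-≤ 2 n<2d) ⟩
      (d + d + 2) + k * 2        ≡⟨ rearrange₂ d k ⟩
      (suc d + suc d) + (k + k)  ≤⟨ +-monoˡ-≤ (k + k) (+-mono-≤ (≰⇒> s≰d) (≰⇒> s≰d)) ⟩
      (s + s) + (k + k)          ≡⟨ rearrange₃ s k ⟩
      (s + k) + (s + k)          ≡⟨ ≡.cong₂ _+_ (m∸n+n≡m (<⇒≤ k<n)) (m∸n+n≡m (<⇒≤ k<n)) ⟩
      n + n                      ∎)) n≤2+2k
      where
      rearrange₁ : ∀ n k → n + (3 + k * 2) ≡ (suc n + 2) + k * 2
      rearrange₁ = solve-∀
      rearrange₂ : ∀ d k → (d + d + 2) + k * 2 ≡ (suc d + suc d) + (k + k)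
      rearrange₂ = solve-∀
      rearrange₃ : ∀ s k → (s + s) + (k + k) ≡ (s + k) + (s + k)
      rearrange₃ = solve-∀

-- Scalar determinants by first-row expansion: linearity in each row and equal first rows.

module Determinant {c ℓ : Level} (F : Field c ℓ) where
  open Field F public hiding (zero)
  open import Algebra.Properties.Ring ring public
    using (-‿distribˡ-*; -‿involutive; -0#≈0#; -‿+-comm)
  open import Algebra.Properties.Semiring.Sum semiring public
    using (sum; sum-syntax; sum-cong-≋; sum-replicate-zero; sum-remove; ∑-distrib-+;
           *-distribˡ-sum; *-distribʳ-sum)
  open import Algebra.Properties.CommutativeSemigroup *-commutativeSemigroup public
    using (x∙yz≈y∙xz)
  open import Algebra.Properties.CommutativeSemigroup +-commutativeSemigroup
    using () renaming (interchange to +-interchange)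
  open import Relation.Binary.Reasoning.Setoid setoid

  Row : ℕ → Set c
  Row m = Fin m → Carrier

  Matrix : ℕ → Set c
  Matrix m = Fin m → Row m

  sum-zero : ∀ {m} {f : Row m} → (∀ i → f i ≈ 0#) → sum f ≈ 0#
  sum-zero {m} f≈0 = trans (sum-cong-≋ f≈0) (sum-replicate-zero m)

  sum-single : ∀ {m} {f : Row m} q → (∀ i → i ≢ q → f i ≈ 0#) → sum f ≈ f q
  sum-single {f = f} zero f≈0 = trans (+-congˡ (sum-zero λ i → f≈0 (suc i) λ ())) (+-identityʳ _)
  sum-single {f = f} (suc q) f≈0 = trans
    (+-cong (f≈0 zero λ ()) (sum-single q λ i i≢q → f≈0 (suc i) (i≢q ∘ suc-injective)))
    (+-identityˡ _)

  sum-linear : ∀ {m} x (f g : Row m) → ∑[ i < m ] (x * f i + g i) ≈ x * sum f + sum g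
  sum-linear x f g = trans (∑-distrib-+ (λ i → x * f i) g) (+-congʳ (sym (*-distribˡ-sum x f)))

  sg : ℕ → Carrier
  sg zero    = 1#
  sg (suc k) = - sg k

  minor : ∀ {m} → Matrix (suc m) → Fin (suc m) → Matrix m
  minor A j r s = A (suc r) (punchIn j s)

  detF : ∀ {m} → Matrix m → Carrier
  detF {zero}  A = 1#
  detF {suc m} A = ∑[ j < suc m ] (sg (toℕ j) * (A zero j * detF (minor A j)))

  det-cong : ∀ {m} {A B : Matrix m} → (∀ r j → A r j ≈ B r j) → detF A ≈ detF B
  det-cong {zero}  A≈B = refl
  det-cong {suc m} A≈B = sum-cong-≋ λ j →
    *-congˡ {sg (toℕ j)} (*-cong (A≈B zero j) (det-cong λ r s → A≈B (suc r) (punchIn j s)))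

  AgreeOff : ∀ {m} → Fin m → Matrix m → Matrix m → Set ℓ
  AgreeOff p A B = ∀ r → r ≢ p → ∀ j → A r j ≈ B r j

  -- Three matrices agreeing off row p, rather than row updates, let the induction pass to minors.
  -- The form `x * A p j + B p j` covers additivity and homogeneity at once.
  det-linear : ∀ {m} p {A B C : Matrix m} x → AgreeOff p C A → AgreeOff p C B →
               (∀ j → C p j ≈ x * A p j + B p j) → detF C ≈ x * detF A + detF B
  det-linear {suc m} zero {A} {B} {C} x CA CB Cp = trans
    (sum-cong-≋ term)
    (sum-linear x (λ j → sg (toℕ j) * (A zero j * detF (minor A j)))
                  (λ j → sg (toℕ j) * (B zero j * detF (minor B j))))
    where
    term : ∀ j → sg (toℕ j) * (C zero j * detF (minor C j)) ≈
                 x * (sg (toℕ j) * (A zero j * detF (minor A j))) + sg (toℕ j) * (B zero j * detF (minor B j))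
    term j = begin
      s * (C zero j * detF (minor C j))
        ≈⟨ *-congˡ (*-congʳ (Cp j)) ⟩
      s * ((x * a + b) * detF (minor C j))
        ≈⟨ *-congˡ (distribʳ _ _ _) ⟩
      s * ((x * a) * detF (minor C j) + b * detF (minor C j))
        ≈⟨ *-congˡ (+-cong
             (trans (*-assoc _ _ _) (*-congˡ (*-congˡ (det-cong λ r t → CA (suc r) (λ ()) (punchIn j t)))))
             (*-congˡ (det-cong λ r t → CB (suc r) (λ ()) (punchIn j t)))) ⟩
      s * (x * (a * detF (minor A j)) + b * detF (minor B j))
        ≈⟨ distribˡ _ _ _ ⟩
      s * (x * (a * detF (minor A j))) + s * (b * detF (minor B j))
        ≈⟨ +-congʳ (x∙yz≈y∙xz _ _ _) ⟩
      x * (s * (a * detF (minor A j))) + s * (b * detF (minor B j)) ∎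
      where
      s = sg (toℕ j)
      a = A zero j
      b = B zero j
  det-linear {suc m} (suc p) {A} {B} {C} x CA CB Cp = trans
    (sum-cong-≋ term)
    (sum-linear x (λ j → sg (toℕ j) * (A zero j * detF (minor A j)))
                  (λ j → sg (toℕ j) * (B zero j * detF (minor B j))))
    where
    term : ∀ j → sg (toℕ j) * (C zero j * detF (minor C j)) ≈
                 x * (sg (toℕ j) * (A zero j * detF (minor A j))) + sg (toℕ j) * (B zero j * detF (minor B j))
    term j = begin
      s * (C zero j * detF (minor C j))
        ≈⟨ *-congˡ (*-congˡ (det-linear p x
             (λ r r≢p t → CA (suc r) (r≢p ∘ suc-injective) (punchIn j t))
             (λ r r≢p t → CB (suc r) (r≢p ∘ suc-injective) (punchIn j t))
             (λ t → Cp (punchIn j t)))) ⟩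
      s * (C zero j * (x * detF (minor A j) + detF (minor B j)))
        ≈⟨ *-congˡ (distribˡ _ _ _) ⟩
      s * (C zero j * (x * detF (minor A j)) + C zero j * detF (minor B j))
        ≈⟨ *-congˡ (+-cong
             (trans (x∙yz≈y∙xz _ _ _) (*-congˡ (*-congʳ (CA zero (λ ()) j))))
             (*-congʳ (CB zero (λ ()) j))) ⟩
      s * (x * (A zero j * detF (minor A j)) + B zero j * detF (minor B j))
        ≈⟨ distribˡ _ _ _ ⟩
      s * (x * (A zero j * detF (minor A j))) + s * (B zero j * detF (minor B j))
        ≈⟨ +-congʳ (x∙yz≈y∙xz _ _ _) ⟩
      x * (s * (A zero j * detF (minor A j))) + s * (B zero j * detF (minor B j)) ∎
      where
      s = sg (toℕ j)

  -- A zero row is the sum of itself with itself, so linearity gives detF A = detF A + detF A.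
  det-zero-row : ∀ {m} p {A : Matrix m} → (∀ j → A p j ≈ 0#) → detF A ≈ 0#
  det-zero-row p {A} Ap≈0 = begin
    detF A                                  ≈⟨ +-identityˡ _ ⟨
    0# + detF A                             ≈⟨ +-congʳ (-‿inverseˡ _) ⟨
    (- detF A + detF A) + detF A            ≈⟨ +-assoc _ _ _ ⟩
    - detF A + (detF A + detF A)            ≈⟨ +-congˡ (+-congʳ (*-identityˡ _)) ⟨
    - detF A + (1# * detF A + detF A)       ≈⟨ +-congˡ (det-linear p 1# (λ _ _ _ → refl) (λ _ _ _ → refl) row) ⟨
    - detF A + detF A                       ≈⟨ -‿inverseˡ _ ⟩
    0#                                      ∎
    where
    row : ∀ j → A p j ≈ 1# * A p j + A p j
    row j = sym (trans (+-congˡ (Ap≈0 j)) (trans (+-identityʳ _) (*-identityˡ _)))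

  -- The pairs (j , l) index ordered pairs of distinct columns (j , punchIn j l);
  -- the hypothesis says that exchanging the two columns changes the sign of G.
  ∑∑-antisymmetric : ∀ {m} (G : Fin (suc m) → Fin m → Carrier) →
    (∀ i j → toℕ j ℕ.≤ toℕ i → G (suc i) j + G (inject₁ j) i ≈ 0#) →
    ∑[ j < suc m ] (∑[ l < m ] G j l) ≈ 0#
  ∑∑-antisymmetric {zero}  G anti = +-identityʳ _
  ∑∑-antisymmetric {suc m} G anti = begin
    ∑[ l < suc m ] G zero l + ∑[ j < suc m ] (G (suc j) zero + ∑[ l < m ] G (suc j) (suc l))
      ≈⟨ +-congˡ (∑-distrib-+ (λ j → G (suc j) zero) (λ j → ∑[ l < m ] G (suc j) (suc l))) ⟩
    ∑[ l < suc m ] G zero l + (∑[ j < suc m ] G (suc j) zero + ∑[ j < suc m ] (∑[ l < m ] G (suc j) (suc l)))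
      ≈⟨ +-assoc _ _ _ ⟨
    (∑[ l < suc m ] G zero l + ∑[ j < suc m ] G (suc j) zero) + ∑[ j < suc m ] (∑[ l < m ] G (suc j) (suc l))
      -- The pairs whose first column is `zero` cancel those whose second column is `zero`; the
      -- remaining pairs form the same sum with one column less.
      ≈⟨ +-cong
           (trans (trans (+-comm _ _) (sym (∑-distrib-+ (λ i → G (suc i) zero) (G zero))))
                  (sum-zero λ i → anti i zero z≤n))
           (∑∑-antisymmetric (λ j l → G (suc j) (suc l)) λ i j j≤i → anti (suc i) (suc j) (s≤s j≤i)) ⟩
    0# + 0#
      ≈⟨ +-identityʳ _ ⟩
    0# ∎

  punchIn-suc-≤ : ∀ {m} (i j : Fin m) → toℕ j ℕ.≤ toℕ i → punchIn (suc i) j ≡ inject₁ j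
  punchIn-suc-≤ i       zero    _         = ≡.refl
  punchIn-suc-≤ (suc i) (suc j) (s≤s j≤i) = ≡.cong suc (punchIn-suc-≤ i j j≤i)

  punchIn-inject₁-≤ : ∀ {m} (i j : Fin m) → toℕ j ℕ.≤ toℕ i → punchIn (inject₁ j) i ≡ suc i
  punchIn-inject₁-≤ i       zero    _         = ≡.refl
  punchIn-inject₁-≤ (suc i) (suc j) (s≤s j≤i) = ≡.cong suc (punchIn-inject₁-≤ i j j≤i)

  -- Deleting the columns `suc i` and `inject₁ j` in either order leaves the same columns, so the
  -- two double minors agree.
  punchIn-punchIn : ∀ {m} (i j : Fin (suc m)) → toℕ j ℕ.≤ toℕ i → ∀ s →
                    punchIn (suc i) (punchIn j s) ≡ punchIn (inject₁ j) (punchIn i s)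
  punchIn-punchIn i       zero    _         s       = ≡.refl
  punchIn-punchIn (suc i) (suc j) (s≤s j≤i) zero    = ≡.refl
  punchIn-punchIn (suc i) (suc j) (s≤s j≤i) (suc s) = ≡.cong suc (punchIn-punchIn i j j≤i s)

  -- Expanding along two rows gives a sum over ordered pairs of distinct columns. Exchanging the
  -- pair keeps the double minor and, as the rows are equal, the product of entries, but flips the
  -- sign.
  det-first-rows-equal : ∀ {m} {A : Matrix (suc (suc m))} →
    (∀ j → A zero j ≈ A (suc zero) j) → detF A ≈ 0#
  det-first-rows-equal {m} {A} A₀≈A₁ = trans (sum-cong-≋ expand) (∑∑-antisymmetric G anti)
    where
    G : Fin (suc (suc m)) → Fin (suc m) → Carrier
    G j l = sg (toℕ j) * (A zero j * (sg (toℕ l) * (A (suc zero) (punchIn j l) * detF (minor (minor A j) l))))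
    expand : ∀ j → sg (toℕ j) * (A zero j * detF (minor A j)) ≈ ∑[ l < suc m ] G j l
    expand j = trans (*-congˡ (*-distribˡ-sum (A zero j) H)) (*-distribˡ-sum (sg (toℕ j)) (λ l → A zero j * H l))
      where
      H : Row (suc m)
      H l = sg (toℕ l) * (A (suc zero) (punchIn j l) * detF (minor (minor A j) l))
    anti : ∀ i j → toℕ j ℕ.≤ toℕ i → G (suc i) j + G (inject₁ j) i ≈ 0#
    anti i j j≤i
      rewrite punchIn-suc-≤ i j j≤i | punchIn-inject₁-≤ i j j≤i | toℕ-inject₁ j = begin
      - s * (A zero (suc i) * (t * (A (suc zero) (inject₁ j) * D))) + t * (A zero (inject₁ j) * (s * (A (suc zero) (suc i) * D′)))
        ≈⟨ +-cong
             (trans (sym (-‿distribˡ-* _ _)) (-‿cong (*-congˡ (*-congʳ (A₀≈A₁ (suc i))))))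
             (*-congˡ (*-cong (A₀≈A₁ (inject₁ j)) (*-congˡ (*-congˡ (det-cong λ r u →
               reflexive (≡.cong (A (suc (suc r))) (≡.sym (punchIn-punchIn i j j≤i u)))))))) ⟩
      - (s * (a * (t * (b * D)))) + t * (b * (s * (a * D)))
        ≈⟨ +-congˡ (begin
             t * (b * (s * (a * D))) ≈⟨ *-congˡ (x∙yz≈y∙xz _ _ _) ⟩
             t * (s * (b * (a * D))) ≈⟨ x∙yz≈y∙xz _ _ _ ⟩
             s * (t * (b * (a * D))) ≈⟨ *-congˡ (*-congˡ (x∙yz≈y∙xz _ _ _)) ⟩
             s * (t * (a * (b * D))) ≈⟨ *-congˡ (x∙yz≈y∙xz _ _ _) ⟩
             s * (a * (t * (b * D))) ∎) ⟩
      - (s * (a * (t * (b * D)))) + s * (a * (t * (b * D)))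
        ≈⟨ -‿inverseˡ _ ⟩
      0# ∎
      where
      s = sg (toℕ i)
      t = sg (toℕ j)
      a = A (suc zero) (suc i)
      b = A (suc zero) (inject₁ j)
      D = detF (minor (minor A (suc i)) j)
      D′ = detF (minor (minor A (inject₁ j)) i)

  -- Row replacement: swapping rows, alternation for arbitrary rows, and rows given as linear
  -- combinations.

  infixl 10 _[_≔_]
  _[_≔_] : ∀ {m} → Matrix m → Fin m → Row m → Matrix m
  A [ p ≔ x ] = updateAt A p (λ _ → x)

  row-≡ : ∀ {m} (A : Matrix m) p x j → (A [ p ≔ x ]) p j ≈ x j
  row-≡ A p x j = reflexive (≡.cong (λ y → y j) (updateAt-updates p A))

  row-≢ : ∀ {m} (A : Matrix m) p x {r} → r ≢ p → ∀ j → (A [ p ≔ x ]) r j ≈ A r j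
  row-≢ A p x r≢p j = reflexive (≡.cong (λ y → y j) (updateAt-minimal _ p A r≢p))

  det-add : ∀ {m} p (A : Matrix m) {x y z} → (∀ j → z j ≈ x j + y j) →
            detF (A [ p ≔ z ]) ≈ detF (A [ p ≔ x ]) + detF (A [ p ≔ y ])
  det-add p A {x} {y} {z} z≈x+y = trans
    (det-linear p 1#
      (λ r r≢p j → trans (row-≢ A p z r≢p j) (sym (row-≢ A p x r≢p j)))
      (λ r r≢p j → trans (row-≢ A p z r≢p j) (sym (row-≢ A p y r≢p j)))
      (λ j → trans (row-≡ A p z j) (trans (z≈x+y j)
        (sym (+-cong (trans (*-identityˡ _) (row-≡ A p x j)) (row-≡ A p y j))))))
    (+-congʳ (*-identityˡ _))

  Alternating : ∀ {m} → Fin m → Fin m → Set (c ⊔ ℓ)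
  Alternating {m} p q = ∀ (A : Matrix m) → (∀ j → A p j ≈ A q j) → detF A ≈ 0#

  row-cong : ∀ {m} {A B : Matrix m} {p x y} → AgreeOff p A B → (∀ j → x j ≈ y j) →
             ∀ r j → (A [ p ≔ x ]) r j ≈ (B [ p ≔ y ]) r j
  row-cong {A = A} {B} {p} {x} {y} A≈B x≈y r j with r ≟ p
  ... | yes ≡.refl = trans (row-≡ A p x j) (trans (x≈y j) (sym (row-≡ B p y j)))
  ... | no  r≢p    = trans (row-≢ A p x r≢p j) (trans (A≈B r r≢p j) (sym (row-≢ B p y r≢p j)))

  row-self : ∀ {m} (A : Matrix m) {p x} → (∀ j → x j ≈ A p j) →
             ∀ r j → (A [ p ≔ x ]) r j ≈ A r j
  row-self A {p} {x} x≈ r j with r ≟ p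
  ... | yes ≡.refl = trans (row-≡ A p x j) (x≈ j)
  ... | no  r≢p    = row-≢ A p x r≢p j

  -- Polarisation: putting the sum of rows p and q in both places gives 0#, and two of the four
  -- terms of its expansion vanish as well. Alternation is assumed for this pair only, because the
  -- lemma is used while alternation is still being proved for other pairs.
  det-swap : ∀ {m} {p q : Fin m} → p ≢ q → Alternating p q → ∀ {A B : Matrix m} →
    (∀ r → r ≢ p → r ≢ q → ∀ j → A r j ≈ B r j) →
    (∀ j → B p j ≈ A q j) → (∀ j → B q j ≈ A p j) → detF A + detF B ≈ 0#
  det-swap {m} {p} {q} p≢q alt {A} {B} A≈B Bp Bq = begin
    detF A + detF B
      ≈⟨ +-cong (sym (det-cong A′)) (sym (det-cong B′)) ⟩
    D x y + D y x
      ≈⟨ +-cong (trans (+-congʳ (D-alt x)) (+-identityˡ _)) (trans (+-congˡ (D-alt y)) (+-identityʳ _)) ⟨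
    (D x x + D x y) + (D y x + D y y)
      ≈⟨ +-cong (det-add q _ λ _ → refl) (det-add q _ λ _ → refl) ⟨
    D x z + D y z
      ≈⟨ +-cong (flip x) (flip y) ⟩
    detF (A [ q ≔ z ] [ p ≔ x ]) + detF (A [ q ≔ z ] [ p ≔ y ])
      ≈⟨ det-add p _ (λ _ → refl) ⟨
    detF (A [ q ≔ z ] [ p ≔ z ])
      ≈⟨ flip z ⟨
    D z z
      ≈⟨ D-alt z ⟩
    0# ∎
    where
    x = A p
    y = A q
    z : Row m
    z j = x j + y j
    D : Row m → Row m → Carrier
    D u v = detF (A [ p ≔ u ] [ q ≔ v ])
    at-p : ∀ u v j → (A [ p ≔ u ] [ q ≔ v ]) p j ≈ u j
    at-p u v j = trans (row-≢ _ q v p≢q j) (row-≡ A p u j)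
    D-alt : ∀ u → D u u ≈ 0#
    D-alt u = alt _ λ j → trans (at-p u u j) (sym (row-≡ _ q u j))
    -- `det-add` splits the row that was updated last, so the two updates have to be exchanged
    -- before row p can be split.
    flip : ∀ u → D u z ≈ detF (A [ q ≔ z ] [ p ≔ u ])
    flip u = det-cong λ r j → lemma r j (r ≟ p) (r ≟ q)
      where
      lemma : ∀ r j → _ → _ → (A [ p ≔ u ] [ q ≔ z ]) r j ≈ (A [ q ≔ z ] [ p ≔ u ]) r j
      lemma r j (yes ≡.refl) _ = trans (at-p u z j) (sym (row-≡ _ p u j))
      lemma r j (no r≢p) (yes ≡.refl) = trans (row-≡ _ q z j) (sym (trans (row-≢ _ p u r≢p j) (row-≡ A q z j)))
      lemma r j (no r≢p) (no r≢q) =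
        trans (trans (row-≢ _ q z r≢q j) (row-≢ A p u r≢p j)) (sym (trans (row-≢ _ p u r≢p j) (row-≢ A q z r≢q j)))
    A′ : ∀ r j → (A [ p ≔ x ] [ q ≔ y ]) r j ≈ A r j
    A′ r j = trans (row-self _ (λ i → sym (row-≢ A p x (p≢q ∘ ≡.sym) i)) r j) (row-self A (λ _ → refl) r j)
    B′ : ∀ r j → (A [ p ≔ y ] [ q ≔ x ]) r j ≈ B r j
    B′ r j with r ≟ p | r ≟ q
    ... | yes ≡.refl | _          = trans (at-p y x j) (sym (Bp j))
    ... | no  r≢p    | yes ≡.refl = trans (row-≡ _ q x j) (sym (Bq j))
    ... | no  r≢p    | no  r≢q    = trans (trans (row-≢ _ q x r≢q j) (row-≢ A p y r≢p j)) (A≈B r r≢p r≢q j)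

  -- Two rows below the first stay equal in every minor of the expansion. For the first row and a
  -- later one, a swap among the lower rows moves the later row to second place, where
  -- `det-first-rows-equal` applies.
  det-alternating : ∀ {m} {p q : Fin m} → p ≢ q → Alternating p q
  det-alternating-suc : ∀ {m} {p q : Fin m} → p ≢ q → Alternating (suc p) (suc q)
  det-alternating-zero : ∀ {m} (q : Fin m) → Alternating zero (suc q)

  det-alternating {p = zero}  {zero}  p≢q     = contradiction ≡.refl p≢q
  det-alternating {p = zero}  {suc q} p≢q     = det-alternating-zero q
  det-alternating {p = suc p} {zero}  p≢q A A≈ = det-alternating-zero p A (sym ∘ A≈)
  det-alternating {p = suc p} {suc q} p≢q     = det-alternating-suc (p≢q ∘ ≡.cong suc)

  det-alternating-suc p≢q A A≈ = sum-zero λ j → trans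
    (*-congˡ {sg (toℕ j)} (trans
      (*-congˡ {A zero j} (det-alternating p≢q (minor A j) (λ s → A≈ (punchIn j s))))
      (zeroʳ _)))
    (zeroʳ _)

  det-alternating-zero zero A A≈ = det-first-rows-equal {A = A} A≈
  det-alternating-zero {suc m} (suc q) A A≈ = begin
    detF A            ≈⟨ +-identityʳ _ ⟨
    detF A + 0#       ≈⟨ +-congˡ (det-first-rows-equal {A = B} A₀≈B₁) ⟨
    detF A + detF B   ≈⟨ det-swap {p = p₁} {q₁} (λ ()) (det-alternating-suc (λ ())) {A} {B}
                          (λ r r≢1 r≢q j → sym (trans (row-≢ C q₁ (A p₁) r≢q j) (row-≢ A p₁ (A q₁) r≢1 j)))
                          (λ j → trans (row-≢ C q₁ (A p₁) {p₁} (λ ()) j) (row-≡ A p₁ (A q₁) j))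
                          (row-≡ C q₁ (A p₁)) ⟩
    0#                ∎
    where
    p₁ q₁ : Fin (suc (suc m))
    p₁ = suc zero
    q₁ = suc (suc q)
    C = A [ p₁ ≔ A q₁ ]
    B = C [ q₁ ≔ A p₁ ]
    A₀≈B₁ : ∀ j → A zero j ≈ A q₁ j
    A₀≈B₁ = A≈

  det-sum : ∀ {m t} p (a : Row t) (V : Fin t → Row m) {Q : Matrix m} →
    (∀ j → Q p j ≈ ∑[ k < t ] (a k * V k j)) →
    detF Q ≈ ∑[ k < t ] (a k * detF (Q [ p ≔ V k ]))
  det-sum {t = zero}  p a V Qp = det-zero-row p Qp
  det-sum {t = suc t} p a V {Q} Qp = trans
    (det-linear p {Q [ p ≔ V zero ]} {Q′} {Q} (a zero)
      (λ r r≢p j → sym (row-≢ Q p _ r≢p j))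
      (λ r r≢p j → sym (row-≢ Q p _ r≢p j))
      (λ j → trans (Qp j) (+-cong (*-congˡ (sym (row-≡ Q p _ j))) (sym (row-≡ Q p _ j)))))
    (+-congˡ (trans
      (det-sum p (a ∘ suc) (V ∘ suc) {Q′} (row-≡ Q p _))
      (sum-cong-≋ λ k → *-congˡ {a (suc k)} (det-cong (row-cong (λ r r≢p → row-≢ Q p _ r≢p) (λ _ → refl))))))
    where
    Q′ = Q [ p ≔ (λ j → ∑[ k < t ] (a (suc k) * V (suc k) j)) ]

  -- After expanding row p, each term with k other than q has coefficient zero or repeats a row of
  -- Q. This is how a row of constants is traded for a single row of a basis.
  det-combination : ∀ {m} p q (a : Row m) (V : Matrix m) {Q : Matrix m} →
    (∀ j → Q p j ≈ ∑[ k < m ] (a k * V k j)) →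
    (∀ k → k ≢ q → a k ≈ 0# ⊎ (k ≢ p × (∀ j → Q k j ≈ V k j))) →
    detF Q ≈ a q * detF (Q [ p ≔ V q ])
  det-combination p q a V {Q} Qp other = trans (det-sum p a V Qp) (sum-single q vanish)
    where
    vanish : ∀ k → k ≢ q → a k * detF (Q [ p ≔ V k ]) ≈ 0#
    vanish k k≢q with other k k≢q
    ... | inj₁ aₖ≈0 = trans (*-congʳ aₖ≈0) (zeroˡ _)
    ... | inj₂ (k≢p , Qₖ≈Vₖ) = trans
      (*-congˡ (det-alternating k≢p (Q [ p ≔ V k ]) λ j →
        trans (row-≢ Q p _ k≢p j) (trans (Qₖ≈Vₖ j) (sym (row-≡ Q p _ j)))))
      (zeroʳ _)

-- Linear dependence: elimination, and the rows of a matrix with nonzero determinant as a spanning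
-- set.

module LinearDependence {c ℓ : Level} (F : Field c ℓ) where
  open Determinant F
  open import Relation.Binary.Reasoning.Setoid setoid

  *-cancel-0 : ∀ {x y} → ¬ y ≈ 0# → x * y ≈ 0# → x ≈ 0#
  *-cancel-0 {x} {y} y≉0 xy≈0 with inverse y y≉0
  ... | y⁻¹ , yy⁻¹≈1 = begin
    x              ≈⟨ *-identityʳ x ⟨
    x * 1#         ≈⟨ *-congˡ yy⁻¹≈1 ⟨
    x * (y * y⁻¹)  ≈⟨ *-assoc _ _ _ ⟨
    (x * y) * y⁻¹  ≈⟨ *-congʳ xy≈0 ⟩
    0# * y⁻¹       ≈⟨ zeroˡ _ ⟩
    0#             ∎

  *-nonzero : ∀ {x y} → ¬ x ≈ 0# → ¬ y ≈ 0# → ¬ x * y ≈ 0#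
  *-nonzero x≉0 y≉0 = x≉0 ∘ *-cancel-0 y≉0

  Dependent : ∀ {t m} → (Fin t → Row m) → Set (c ⊔ ℓ)
  Dependent {t} v = ∃ λ (a : Row t) → (∃ λ p → ¬ a p ≈ 0#) × (∀ j → ∑[ i < t ] (a i * v i j) ≈ 0#)

  -- A step of Gaussian elimination with pivot `v p zero`, cross-multiplied to avoid division; the
  -- cleared first column is dropped.
  eliminate : ∀ {t m} (v : Fin (suc t) → Row (suc m)) p → Fin t → Row m
  eliminate v p i j = v p zero * v (punchIn p i) (suc j) + - v (punchIn p i) zero * v p (suc j)

  -- In a relation among the eliminated rows, the original rows other than p get the coefficients
  -- multiplied by the pivot, and row p collects the multiples that were subtracted.
  dependent-eliminate : ∀ {t m} (v : Fin (suc t) → Row (suc m)) p → ¬ v p zero ≈ 0# →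
                        Dependent (eliminate v p) → Dependent v
  dependent-eliminate {t} v p vp≉0 (a , (q , aq≉0) , Σ≈0) = a⁺ , (punchIn p q , nonzero) , vanish
    where
    x : Carrier
    x = v p zero
    y a′ : Row t
    y i  = v (punchIn p i) zero
    a′ i = x * a i
    s : Carrier
    s = ∑[ i < t ] (a i * - y i)
    a⁺ : Row (suc t)
    a⁺ = insertAt a′ p s
    nonzero : ¬ a⁺ (punchIn p q) ≈ 0#
    nonzero eq = *-nonzero vp≉0 aq≉0 (trans (sym (reflexive (insertAt-punchIn a′ p s q))) eq)
    regroup : ∀ j → ∑[ i < suc t ] (a⁺ i * v i j) ≈
                    ∑[ i < t ] (a i * (x * v (punchIn p i) j + - y i * v p j))
    regroup j = begin
      ∑[ i < suc t ] (a⁺ i * v i j)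
        ≈⟨ sum-remove {i = p} (λ i → a⁺ i * v i j) ⟩
      a⁺ p * v p j + ∑[ i < t ] (a⁺ (punchIn p i) * v (punchIn p i) j)
        ≈⟨ +-comm _ _ ⟩
      ∑[ i < t ] (a⁺ (punchIn p i) * v (punchIn p i) j) + a⁺ p * v p j
        ≈⟨ +-cong
             (sum-cong-≋ λ i → *-congʳ {v (punchIn p i) j} (reflexive (insertAt-punchIn a′ p s i)))
             (trans (*-congʳ (reflexive (insertAt-lookup a′ p s))) (*-distribʳ-sum (v p j) (λ i → a i * - y i))) ⟩
      ∑[ i < t ] (a′ i * v (punchIn p i) j) + ∑[ i < t ] ((a i * - y i) * v p j)
        ≈⟨ ∑-distrib-+ (λ i → a′ i * v (punchIn p i) j) (λ i → (a i * - y i) * v p j) ⟨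
      ∑[ i < t ] (a′ i * v (punchIn p i) j + (a i * - y i) * v p j)
        ≈⟨ sum-cong-≋ (λ i → trans
             (+-cong (trans (*-congʳ (*-comm _ _)) (*-assoc (a i) x (v (punchIn p i) j)))
                     (*-assoc (a i) (- y i) (v p j)))
             (sym (distribˡ (a i) _ _))) ⟩
      ∑[ i < t ] (a i * (x * v (punchIn p i) j + - y i * v p j)) ∎
    vanish : ∀ j → ∑[ i < suc t ] (a⁺ i * v i j) ≈ 0#
    vanish zero = trans (regroup zero) (sum-zero λ i → trans
      (*-congˡ {a i} (begin
        x * y i + - y i * x    ≈⟨ +-cong (*-comm _ _) (sym (-‿distribˡ-* _ _)) ⟩
        y i * x + - (y i * x)  ≈⟨ -‿inverseʳ _ ⟩
        0#                     ∎))
      (zeroʳ _))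
    vanish (suc j) = trans (regroup (suc j)) (Σ≈0 j)

  -- Elimination by induction on the number of columns. Whether the first column contains a pivot is
  -- undecidable, hence the double negation.
  dependent : ∀ {m} (v : Fin (suc m) → Row m) → ¬ ¬ Dependent v
  dependent {zero}  v k = k ((λ _ → 1#) , (zero , 0≉1 ∘ sym) , λ ())
  dependent {suc m} v k = ¬¬-excluded-middle {A = ∃ λ p → ¬ v p zero ≈ 0#} λ
    { (yes (p , vp≉0)) → dependent (eliminate v p) (k ∘ dependent-eliminate v p vp≉0)
    -- The first column is zero. Dropping it together with the first row, which gets coefficient 0#,
    -- keeps one row more than columns.
    ; (no none) → ¬¬-∀ (λ i vi≉0 → none (i , vi≉0)) λ first≈0 →
        dependent (λ i j → v (suc i) (suc j)) λ { (a , (q , aq≉0) , Σ≈0) →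
          k ((λ { zero → 0# ; (suc i) → a i }) , (suc q , aq≉0) ,
             λ { zero    → trans (+-cong (zeroˡ _) (sum-zero λ i →
                             trans (*-congˡ {a i} (first≈0 (suc i))) (zeroʳ _))) (+-identityʳ _)
               ; (suc j) → trans (+-cong (zeroˡ _) (Σ≈0 j)) (+-identityʳ _) }) } }

  -- The zero row is the combination of the rows of N with coefficients `a`. Placed at q, it makes
  -- the determinant both 0# and `a q * detF N`.
  det-dependent : ∀ {m} (N : Matrix m) → Dependent N → detF N ≈ 0#
  det-dependent {m} N (a , (q , aq≉0) , Σ≈0) = *-cancel-0 aq≉0 (begin
    detF N * a q        ≈⟨ *-comm _ _ ⟩
    a q * detF N        ≈⟨ *-congˡ (det-cong N′) ⟨
    a q * detF (Q [ q ≔ N q ])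
      ≈⟨ det-combination q q a N
           (λ j → trans (row-≡ N q _ j) (sym (Σ≈0 j)))
           (λ k k≢q → inj₂ (k≢q , row-≢ N q _ k≢q)) ⟨
    detF Q              ≈⟨ det-zero-row q (row-≡ N q _) ⟩
    0#                  ∎)
    where
    Q : Matrix m
    Q = N [ q ≔ (λ _ → 0#) ]
    N′ : ∀ r j → (Q [ q ≔ N q ]) r j ≈ N r j
    N′ r j = trans (row-cong (λ r r≢q → row-≢ N q _ r≢q) (λ _ → refl) r j) (row-self N (λ _ → refl) r j)

  -- The row r and the m rows of N are dependent, and the coefficient of r is nonzero, since
  -- otherwise the rows of N alone would be dependent. Dividing by it solves for r.
  rows-span : ∀ {m} (N : Matrix m) → ¬ detF N ≈ 0# → ∀ r →
              ¬ ¬ (∃ λ (a : Row m) → ∀ j → r j ≈ ∑[ k < m ] (a k * N k j))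
  rows-span {m} N det≉0 r k = dependent v λ { (a , p , Σ≈0) → k (combination a p Σ≈0) }
    where
    v : Fin (suc m) → Row m
    v zero    = r
    v (suc i) = N i
    combination : ∀ a → (∃ λ p → ¬ a p ≈ 0#) → (∀ j → ∑[ i < suc m ] (a i * v i j) ≈ 0#) →
                  ∃ λ (b : Row m) → ∀ j → r j ≈ ∑[ k < m ] (b k * N k j)
    combination a (p , ap≉0) Σ≈0 with inverse (a zero) (a₀≉0 p ap≉0)
      where
      a₀≉0 : ∀ p → ¬ a p ≈ 0# → ¬ a zero ≈ 0#
      a₀≉0 zero    ap≉0 = ap≉0
      a₀≉0 (suc q) ap≉0 a₀≈0 = det≉0 (det-dependent N (a ∘ suc , (q , ap≉0) , λ j →
        trans (sym (+-identityˡ _)) (trans (+-congʳ (sym (trans (*-congʳ a₀≈0) (zeroˡ _)))) (Σ≈0 j))))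
    ... | y , a₀y≈1 = (λ k → - y * a (suc k)) , λ j → begin
      r j
        ≈⟨ *-identityˡ _ ⟨
      1# * r j
        ≈⟨ *-congʳ (trans (*-comm _ _) a₀y≈1) ⟨
      (y * a zero) * r j
        ≈⟨ *-assoc _ _ _ ⟩
      y * (a zero * r j)
        ≈⟨ +-identityʳ _ ⟨
      y * (a zero * r j) + 0#
        ≈⟨ +-congˡ (-‿inverseʳ _) ⟨
      y * (a zero * r j) + (y * S j + - (y * S j))
        ≈⟨ +-assoc _ _ _ ⟨
      (y * (a zero * r j) + y * S j) + - (y * S j)
        ≈⟨ +-cong (trans (sym (distribˡ _ _ _)) (trans (*-congˡ (Σ≈0 j)) (zeroʳ _))) (-‿distribˡ-* _ _) ⟩
      0# + - y * S j
        ≈⟨ +-identityˡ _ ⟩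
      - y * S j
        ≈⟨ *-distribˡ-sum (- y) (λ k → a (suc k) * N k j) ⟩
      ∑[ k < m ] (- y * (a (suc k) * N k j))
        ≈⟨ sum-cong-≋ (λ k → sym (*-assoc (- y) (a (suc k)) (N k j))) ⟩
      ∑[ k < m ] ((- y * a (suc k)) * N k j) ∎
      where
      S : Row m
      S j = ∑[ k < m ] (a (suc k) * N k j)

-- Coefficients of a polynomial determinant along its first-row expansion.

module Expansion {c ℓ : Level} (F : Field c ℓ) (n : ℕ) where
  open Poly F n
  open Determinant F
  open import Relation.Binary.Reasoning.Setoid setoid

  -- `signed` and `laplace` are nameable copies of the local functions of `det`.
  signed : ℕ → Polynomial → Polynomial
  signed zero          p = p
  signed (suc zero)    p = neg p
  signed (suc (suc t)) p = signed t p

  PolyMatrix : ℕ → Set c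
  PolyMatrix m = Fin m → Fin m → Polynomial

  minorP : ∀ {m} → PolyMatrix (suc m) → Fin (suc m) → PolyMatrix m
  minorP A j r s = A (suc r) (punchIn j s)

  laplace : ∀ {m} (A : PolyMatrix (suc m)) → ℕ → List (Fin (suc m)) → Polynomial
  laplace A k []       = []
  laplace A k (j ∷ js) = signed k (A zero j ⊗ det (minorP A j)) ⊕ laplace A (suc k) js

  -- det is defined through local functions that cannot be named here; the
  -- left-hand sides below are metavariables that unification fills with them,
  -- and the with-abstractions only serve to bring these into pattern form.
  mutual
    det-laplace : ∀ {m} (A : PolyMatrix (suc m)) → det A ≡ laplace A 0 (List.allFin (suc m))
    det-laplace {m} A with 1 | List.tabulate {n = m} Fin.suc
    ... | k | js = ≡.cong (_ ++_) (go≡ A k js)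

    go≡ : ∀ {m} (A : PolyMatrix (suc m)) (k : ℕ) js → _ ≡ laplace A k js
    go≡ A k             []       = ≡.refl
    go≡ A zero          (j ∷ js) = ≡.cong (_ ++_) (go≡ A 1 js)
    go≡ A (suc zero)    (j ∷ js) = ≡.cong (_ ++_) (go≡ A 2 js)
    go≡ A (suc (suc k)) (j ∷ js) = ≡.cong₂ _++_ (step≡ A k j js) (go≡ A (suc (suc (suc k))) js)

    step≡ : ∀ {m} (A : PolyMatrix (suc m)) (k : ℕ) j js → _ ≡ signed k (A zero j ⊗ det (minorP A j))
    step≡ A k j js with ℕ.suc (ℕ.suc k)
    ... | k′ = sgn≡ A k′ j js k

    sgn≡ : ∀ {m} (A : PolyMatrix (suc m)) (k : ℕ) j js t → _ ≡ signed t (A zero j ⊗ det (minorP A j))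
    sgn≡ A k j js zero          = ≡.refl
    sgn≡ A k j js (suc zero)    = ≡.refl
    sgn≡ A k j js (suc (suc t)) = sgn≡ A k j js t

  coeff-++ : ∀ p q α → coeff (p ++ q) α ≈ coeff p α + coeff q α
  coeff-++ []            q α = sym (+-identityˡ _)
  coeff-++ ((a , e) ∷ p) q α with ≡-dec ℕ._≟_ e α
  ... | yes _ = trans (+-congˡ (coeff-++ p q α)) (sym (+-assoc _ _ _))
  ... | no  _ = coeff-++ p q α

  coeff-neg : ∀ p α → coeff (neg p) α ≈ - coeff p α
  coeff-neg []            α = sym -0#≈0#
  coeff-neg ((a , e) ∷ p) α with ≡-dec ℕ._≟_ e α
  ... | yes _ = trans (+-congˡ (coeff-neg p α)) (-‿+-comm _ _)
  ... | no  _ = coeff-neg p α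

  coeff-signed : ∀ k p α → coeff (signed k p) α ≈ sg k * coeff p α
  coeff-signed zero          p α = sym (*-identityˡ _)
  coeff-signed (suc zero)    p α = trans (coeff-neg p α)
    (trans (-‿cong (sym (*-identityˡ _))) (-‿distribˡ-* _ _))
  coeff-signed (suc (suc k)) p α = trans (coeff-signed k p α) (*-congʳ (sym (-‿involutive _)))

  -- f stands for the local function by which _⊗_ multiplies by the term a x^e.
  module _ (a : Carrier) (e : Monomial) {f : Carrier × Monomial → Carrier × Monomial}
           (f≡ : ∀ b e′ → f (b , e′) ≡ (a * b , zipWith ℕ._+_ e e′)) where

    -- By `cancel`, β is the only exponent that the shift by e sends to α, so a term counts on the
    -- left exactly when it counts on the right. The trailing `++ []` is what `concatMap` leaves for
    -- a one-term left factor.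
    coeff-term-shift : ∀ {α β} → (∀ e′ → zipWith ℕ._+_ e e′ ≡ α → e′ ≡ β) → zipWith ℕ._+_ e β ≡ α →
                       ∀ q → coeff (List.map f q ++ []) α ≈ a * coeff q β
    coeff-term-shift cancel e+β≡α [] = sym (zeroʳ a)
    coeff-term-shift {α} {β} cancel e+β≡α ((b , e′) ∷ q)
      rewrite f≡ b e′ with ≡-dec ℕ._≟_ (zipWith ℕ._+_ e e′) α | ≡-dec ℕ._≟_ e′ β
    ... | yes _ | yes _ = trans (+-congˡ (coeff-term-shift cancel e+β≡α q)) (sym (distribˡ _ _ _))
    ... | no  _ | no  _ = coeff-term-shift cancel e+β≡α q
    ... | yes p | no  r = contradiction (cancel e′ p) r
    ... | no  p | yes ≡.refl = contradiction e+β≡α p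

    coeff-term-absent : ∀ {α} → (∀ e′ → zipWith ℕ._+_ e e′ ≢ α) →
                        ∀ q → coeff (List.map f q ++ []) α ≈ 0#
    coeff-term-absent e∤α [] = refl
    coeff-term-absent {α} e∤α ((b , e′) ∷ q)
      rewrite f≡ b e′ with ≡-dec ℕ._≟_ (zipWith ℕ._+_ e e′) α
    ... | yes p = contradiction p (e∤α e′)
    ... | no  _ = coeff-term-absent e∤α q

  unit : ∀ {k} → Fin k → Vec ℕ k
  unit {k} i = Vec.updateAt (replicate k 0) i (λ _ → 1)

  0⊹ : ∀ {k} (e : Vec ℕ k) → zipWith ℕ._+_ (replicate k 0) e ≡ e
  0⊹ []      = ≡.refl
  0⊹ (x ∷ e) = ≡.cong (x ∷_) (0⊹ e)

  unit⊹-indicator : ∀ {k} (S : Vec Bool k) i → lookup S i ≡ true →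
    zipWith ℕ._+_ (unit i) (Vec.map bit (S [ i ]≔ false)) ≡ Vec.map bit S
  unit⊹-indicator (true ∷ S) zero    _   = ≡.cong (1 ∷_) (0⊹ _)
  unit⊹-indicator (b ∷ S)    (suc i) i∈S = ≡.cong (bit b ∷_) (unit⊹-indicator S i i∈S)

  unit⊹-cancel : ∀ {k} i {e e′ : Vec ℕ k} →
    zipWith ℕ._+_ (unit i) e ≡ zipWith ℕ._+_ (unit i) e′ → e ≡ e′
  unit⊹-cancel zero    {x ∷ e} {x′ ∷ e′} eq with ≡.cong Vec.head eq | ≡.cong Vec.tail eq
  ... | ≡.refl | p = ≡.cong (x ∷_) (≡.trans (≡.sym (0⊹ e)) (≡.trans p (0⊹ e′)))
  unit⊹-cancel (suc i) {x ∷ e} {x′ ∷ e′} eq = ≡.cong₂ _∷_ (≡.cong Vec.head eq) (unit⊹-cancel i (≡.cong Vec.tail eq))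

  unit⊹-absent : ∀ {k} (S : Vec Bool k) i → lookup S i ≡ false →
    ∀ e → zipWith ℕ._+_ (unit i) e ≢ Vec.map bit S
  unit⊹-absent (false ∷ S) zero    _   (x ∷ e) eq with ≡.cong Vec.head eq
  ... | ()
  unit⊹-absent (b ∷ S)     (suc i) i∉S (x ∷ e) eq = unit⊹-absent S i i∉S e (≡.cong Vec.tail eq)

  -- Trades the anonymous function inside `indicator` for a named one on which lemmas can be stated.
  indicator-bit : ∀ S → indicator S ≡ Vec.map bit S
  indicator-bit S = map-cong (λ { true → ≡.refl ; false → ≡.refl }) S

  coeffOf : Polynomial → Subset n → Carrier
  coeffOf p S = coeff p (indicator S)

  coeffOf-const : ∀ a q S → coeffOf (const a ⊗ q) S ≈ a * coeffOf q S
  coeffOf-const a q S = coeff-term-shift a _ (λ _ _ → ≡.refl)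
    (λ e′ eq → ≡.trans (≡.sym (0⊹ e′)) eq) (0⊹ _) q

  coeffOf-var-∈ : ∀ i q S → lookup S i ≡ true → coeffOf (var i ⊗ q) S ≈ coeffOf q (S [ i ]≔ false)
  coeffOf-var-∈ i q S i∈S
    rewrite indicator-bit S | indicator-bit (S [ i ]≔ false) = trans
    (coeff-term-shift 1# _ (λ _ _ → ≡.refl)
      (λ e′ eq → unit⊹-cancel i (≡.trans eq (≡.sym (unit⊹-indicator S i i∈S))))
      (unit⊹-indicator S i i∈S) q)
    (*-identityˡ _)

  coeffOf-var-∉ : ∀ i q S → lookup S i ≡ false → coeffOf (var i ⊗ q) S ≈ 0#
  coeffOf-var-∉ i q S i∉S rewrite indicator-bit S =
    coeff-term-absent 1# _ (λ _ _ → ≡.refl) (unit⊹-absent S i i∉S) q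

  -- The start index k and the enumeration g are arbitrary because the tail of `allFin` tabulates a
  -- shifted function.
  coeff-laplace : ∀ {m} (A : PolyMatrix (suc m)) α k {t} (g : Fin t → Fin (suc m)) →
    coeff (laplace A k (List.tabulate g)) α ≈
    ∑[ j < t ] (sg (k ℕ.+ toℕ j) * coeff (A zero (g j) ⊗ det (minorP A (g j))) α)
  coeff-laplace A α k {zero}  g = refl
  coeff-laplace A α k {suc t} g = trans
    (coeff-++ (signed k (A zero (g zero) ⊗ det (minorP A (g zero)))) _ α)
    (+-cong
      (trans (coeff-signed k (A zero (g zero) ⊗ det (minorP A (g zero))) α)
             (*-congʳ (reflexive (≡.cong sg (≡.sym (ℕₚ.+-identityʳ k))))))
      (trans (coeff-laplace A α (suc k) (g ∘ suc))
             (sum-cong-≋ λ j → *-congʳ {coeff (A zero (g (suc j)) ⊗ det (minorP A (g (suc j)))) α} (reflexive (≡.cong sg (≡.sym (ℕₚ.+-suc k (toℕ j))))))))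

  coeff-det : ∀ {m} (A : PolyMatrix (suc m)) α →
    coeff (det A) α ≈ ∑[ j < suc m ] (sg (toℕ j) * coeff (A zero j ⊗ det (minorP A j)) α)
  coeff-det A α = trans (reflexive (≡.cong (λ p → coeff p α) (det-laplace A))) (coeff-laplace A α 0 (λ j → j))

-- Squarefree coefficients of the determinant of a matrix of variables and constants.

module Coefficients {c ℓ : Level} (F : Field c ℓ) (n : ℕ) where
  open Poly F n
  open Determinant F
  open Expansion F n
  open import Relation.Binary.Reasoning.Setoid setoid

  EntryMatrix : ℕ → Set c
  EntryMatrix m = Fin m → Fin m → Entry

  minorE : ∀ {m} → EntryMatrix (suc m) → Fin (suc m) → EntryMatrix m
  minorE M j r s = M (suc r) (punchIn j s)

  detCoeff : ∀ {m} → EntryMatrix m → Subset n → Carrier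
  detCoeff M = coeffOf (det (λ i j → entry (M i j)))

  detCoeff-expand : ∀ {m} (M : EntryMatrix (suc m)) S {f : Row (suc m)} →
    (∀ j → coeffOf (entry (M zero j) ⊗ det (λ r s → entry (minorE M j r s))) S ≈ f j) →
    detCoeff M S ≈ ∑[ j < suc m ] (sg (toℕ j) * f j)
  detCoeff-expand M S f≈ = trans
    (coeff-det (λ i j → entry (M i j)) (indicator S))
    (sum-cong-≋ λ j → *-congˡ {sg (toℕ j)} (f≈ j))

  term-vanish : ∀ e q S →
    (∀ a → e ≡ inj₂ a → coeffOf q S ≈ 0#) →
    (∀ u → e ≡ inj₁ u → lookup S u ≡ true → coeffOf q (S [ u ]≔ false) ≈ 0#) →
    coeffOf (entry e ⊗ q) S ≈ 0#
  term-vanish (inj₂ a) q S const≈0 var≈0 =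
    trans (coeffOf-const a q S) (trans (*-congˡ (const≈0 a ≡.refl)) (zeroʳ a))
  term-vanish (inj₁ u) q S const≈0 var≈0 with lookup S u in eq
  ... | true  = trans (coeffOf-var-∈ u q S eq) (var≈0 u ≡.refl eq)
  ... | false = coeffOf-var-∉ u q S eq

  detCoeff-vanish : ∀ {m} (M : EntryMatrix (suc m)) S →
    (∀ j a → M zero j ≡ inj₂ a → detCoeff (minorE M j) S ≈ 0#) →
    (∀ j u → M zero j ≡ inj₁ u → lookup S u ≡ true → detCoeff (minorE M j) (S [ u ]≔ false) ≈ 0#) →
    detCoeff M S ≈ 0#
  detCoeff-vanish {m} M S const≈0 var≈0 = trans
    (detCoeff-expand M S {λ _ → 0#} λ j → term-vanish (M zero j) (det (λ r s → entry (minorE M j r s))) S (const≈0 j) (var≈0 j))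
    (sum-zero {suc m} λ j → zeroʳ (sg (toℕ j)))

  -- The variables removed from S during the expansion are entries of M, hence not w. So w is still
  -- in S at the empty determinant, which is constant.
  detCoeff-absent : ∀ {m} (M : EntryMatrix m) S w → lookup S w ≡ true →
    (∀ i j → M i j ≢ inj₁ w) → detCoeff M S ≈ 0#
  detCoeff-absent {zero} M S w w∈S absent with ≡-dec ℕ._≟_ (replicate n 0) (indicator S)
  ... | no  _ = refl
  ... | yes p = contradiction
    (≡.trans (≡.sym (lookup-replicate w 0))
      (≡.trans (≡.cong (λ α → lookup α w) (≡.trans p (indicator-bit S)))
        (≡.trans (lookup-map w bit S) (≡.cong bit w∈S))))
    λ ()
  detCoeff-absent {suc m} M S w w∈S absent = detCoeff-vanish M S
    (λ j a _ → detCoeff-absent (minorE M j) S w w∈S λ r s → absent (suc r) (punchIn j s))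
    (λ j u M₀ⱼ≡u _ → detCoeff-absent (minorE M j) (S [ u ]≔ false) w
      (≡.trans (lookup∘update′ (λ { ≡.refl → absent zero j M₀ⱼ≡u }) S false) w∈S)
      λ r s → absent (suc r) (punchIn j s))

  -- A term of the determinant takes a single entry from row i, so after that row at least one of v
  -- and w is still required and no longer occurs.
  detCoeff-two-in-row : ∀ {m} (M : EntryMatrix m) S i {v w} → v ≢ w → lookup S v ≡ true → lookup S w ≡ true →
    (∀ r s → M r s ≡ inj₁ v → r ≡ i) → (∀ r s → M r s ≡ inj₁ w → r ≡ i) → detCoeff M S ≈ 0#
  detCoeff-two-in-row M S zero {v} {w} v≢w v∈S w∈S onlyv onlyw = detCoeff-vanish M S
    (λ j a _ → detCoeff-absent (minorE M j) S v v∈S (no-v j))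
    remove
    where
    no-v : ∀ j r s → minorE M j r s ≢ inj₁ v
    no-v j r s eq with onlyv (suc r) (punchIn j s) eq
    ... | ()
    no-w : ∀ j r s → minorE M j r s ≢ inj₁ w
    no-w j r s eq with onlyw (suc r) (punchIn j s) eq
    ... | ()
    remove : ∀ j u → M zero j ≡ inj₁ u → lookup S u ≡ true → detCoeff (minorE M j) (S [ u ]≔ false) ≈ 0#
    remove j u _ _ with u ≟ v
    ... | yes ≡.refl = detCoeff-absent (minorE M j) _ w (≡.trans (lookup∘update′ (v≢w ∘ ≡.sym) S false) w∈S) (no-w j)
    ... | no  u≢v    = detCoeff-absent (minorE M j) _ v (≡.trans (lookup∘update′ (u≢v ∘ ≡.sym) S false) v∈S) (no-v j)
  detCoeff-two-in-row M S (suc i) {v} {w} v≢w v∈S w∈S onlyv onlyw = detCoeff-vanish M S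
    (λ j a _ → detCoeff-two-in-row (minorE M j) S i v≢w v∈S w∈S (below onlyv j) (below onlyw j))
    (λ j u M₀ⱼ≡u _ → detCoeff-two-in-row (minorE M j) (S [ u ]≔ false) i v≢w
      (≡.trans (lookup∘update′ (not-first onlyv j M₀ⱼ≡u) S false) v∈S)
      (≡.trans (lookup∘update′ (not-first onlyw j M₀ⱼ≡u) S false) w∈S)
      (below onlyv j) (below onlyw j))
    where
    below : ∀ {x} → (∀ r s → M r s ≡ inj₁ x → r ≡ suc i) → ∀ j r s → minorE M j r s ≡ inj₁ x → r ≡ i
    below only j r s = suc-injective ∘ only (suc r) (punchIn j s)
    not-first : ∀ {x u} → (∀ r s → M r s ≡ inj₁ x → r ≡ suc i) → ∀ j → M zero j ≡ inj₁ u → x ≢ u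
    not-first only j eq ≡.refl with only zero j eq
    ... | ()

  select : Bool → Entry → Carrier
  select true  (inj₁ _) = 1#
  select true  (inj₂ _) = 0#
  select false (inj₁ _) = 0#
  select false (inj₂ a) = a

  active : Subset n → Maybe (Fin n) → Bool
  active S = maybe (lookup S) false

  -- `ρ i` may name a variable that does not occur in row i, because passing to a minor can delete
  -- its column.
  record RowVariables {m} (M : EntryMatrix m) (ρ : Fin m → Maybe (Fin n)) : Set c where
    field
      only      : ∀ i j w → M i j ≡ inj₁ w → ρ i ≡ just w
      injective : ∀ i i′ w → ρ i ≡ just w → ρ i′ ≡ just w → i ≡ i′

  rowVariables-minor : ∀ {m} {M : EntryMatrix (suc m)} {ρ} → RowVariables M ρ →
                       ∀ j → RowVariables (minorE M j) (ρ ∘ suc)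
  rowVariables-minor rv j = record
    { only      = λ r s → only (suc r) (punchIn j s)
    ; injective = λ r r′ w p q → suc-injective (injective (suc r) (suc r′) w p q)
    } where open RowVariables rv

  -- Row i of M is a constant row plus x_w times a 0-1 row, where ρ i = just w.
  -- The coefficient of x^S picks the 0-1 row for w ∈ S and the constant row otherwise.
  detCoeff-select : ∀ {m} (M : EntryMatrix m) ρ S → RowVariables M ρ →
    (∀ w → lookup S w ≡ true → ∃ λ i → ρ i ≡ just w) →
    detCoeff M S ≈ detF (λ i j → select (active S (ρ i)) (M i j))
  detCoeff-select {zero} M ρ S rv covered with ≡-dec ℕ._≟_ (replicate n 0) (indicator S)
  ... | yes _ = +-identityʳ 1#
  -- Without rows, `covered` forces S to be empty, so its indicator is the exponent of the constant
  -- 1#.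
  ... | no  p = contradiction (≡.sym (≡.trans (indicator-bit S) (S≡0 S uncovered))) p
    where
    uncovered : ∀ w → lookup S w ≡ false
    uncovered w with lookup S w in eq
    ... | false = ≡.refl
    ... | true with covered w eq
    ...   | () , _
    S≡0 : ∀ {k} (T : Vec Bool k) → (∀ w → lookup T w ≡ false) → Vec.map bit T ≡ replicate k 0
    S≡0 []      _ = ≡.refl
    S≡0 (b ∷ T) f = ≡.cong₂ _∷_ (≡.cong bit (f zero)) (S≡0 T (f ∘ suc))
  detCoeff-select {suc m} M ρ S rv covered = detCoeff-expand M S term
    where
    open RowVariables rv
    N : Matrix (suc m)
    N i j = select (active S (ρ i)) (M i j)
    tail-covered : ρ zero ≡ nothing ⊎ (∃ λ w → ρ zero ≡ just w × lookup S w ≡ false) →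
                   ∀ w → lookup S w ≡ true → ∃ λ i → ρ (suc i) ≡ just w
    tail-covered h w w∈S with covered w w∈S
    ... | suc i , eq = i , eq
    tail-covered (inj₁ none) w w∈S | zero , eq with ≡.trans (≡.sym none) eq
    ... | ()
    tail-covered (inj₂ (v , eq′ , v∉S)) w w∈S | zero , eq with just-injective (≡.trans (≡.sym eq′) eq)
    ... | ≡.refl with ≡.trans (≡.sym w∈S) v∉S
    ... | ()
    -- The first row has no variable in S: a variable entry contributes 0#, and the remaining rows
    -- still cover S.
    inactive : ρ zero ≡ nothing ⊎ (∃ λ w → ρ zero ≡ just w × lookup S w ≡ false) →
               ∀ j → coeffOf (entry (M zero j) ⊗ det (λ r s → entry (minorE M j r s))) S ≈
                     select false (M zero j) * detF (minor N j)
    inactive h j with M zero j in eq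
    ... | inj₂ a = trans (coeffOf-const a (det (λ r s → entry (minorE M j r s))) S)
      (*-congˡ (detCoeff-select (minorE M j) (ρ ∘ suc) S (rowVariables-minor rv j) (tail-covered h)))
    ... | inj₁ w with only zero j w eq | h
    ...   | ρ₀≡w | inj₁ none = contradiction (≡.trans (≡.sym ρ₀≡w) none) λ ()
    ...   | ρ₀≡w | inj₂ (v , ρ₀≡v , v∉S) with just-injective (≡.trans (≡.sym ρ₀≡w) ρ₀≡v)
    ...     | ≡.refl = trans (coeffOf-var-∉ w (det (λ r s → entry (minorE M j r s))) S v∉S) (sym (zeroˡ _))
    -- No other row contains w, so a constant entry leaves a minor without w and contributes 0#. The
    -- entry `var w` accounts for w, which is then removed from S.
    chosen : ∀ w → ρ zero ≡ just w → lookup S w ≡ true →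
             ∀ j → coeffOf (entry (M zero j) ⊗ det (λ r s → entry (minorE M j r s))) S ≈
                   select true (M zero j) * detF (minor N j)
    chosen w ρ₀≡w w∈S j with M zero j in eq
    ... | inj₂ a = trans (coeffOf-const a (det (λ r s → entry (minorE M j r s))) S) (trans
      (*-congˡ (detCoeff-absent (minorE M j) S w w∈S λ r s eq′ →
        contradiction (injective zero (suc r) w ρ₀≡w (only (suc r) (punchIn j s) w eq′)) λ ()))
      (trans (zeroʳ a) (sym (zeroˡ _))))
    ... | inj₁ u with just-injective (≡.trans (≡.sym ρ₀≡w) (only zero j u eq))
    ...   | ≡.refl = begin
      coeffOf (var w ⊗ det (λ r s → entry (minorE M j r s))) S
        ≈⟨ coeffOf-var-∈ w (det (λ r s → entry (minorE M j r s))) S w∈S ⟩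
      detCoeff (minorE M j) S′
        ≈⟨ detCoeff-select (minorE M j) (ρ ∘ suc) S′ (rowVariables-minor rv j) covered′ ⟩
      detF (λ r s → select (active S′ (ρ (suc r))) (minorE M j r s))
        ≈⟨ det-cong (λ r s → reflexive (≡.cong (λ b → select b (minorE M j r s)) (same r))) ⟩
      detF (minor N j)
        ≈⟨ *-identityˡ _ ⟨
      1# * detF (minor N j) ∎
      where
      S′ = S [ w ]≔ false
      covered′ : ∀ v → lookup S′ v ≡ true → ∃ λ i → ρ (suc i) ≡ just v
      covered′ v v∈S′ with v ≟ w
      ... | yes ≡.refl = contradiction (≡.trans (≡.sym v∈S′) (lookup∘update w S false)) λ ()
      ... | no  v≢w with covered v (≡.trans (≡.sym (lookup∘update′ v≢w S false)) v∈S′)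
      ...   | suc i , p = i , p
      ...   | zero  , p = contradiction (just-injective (≡.trans (≡.sym p) ρ₀≡w)) v≢w
      same : ∀ r → active S′ (ρ (suc r)) ≡ active S (ρ (suc r))
      same r with ρ (suc r) in p
      ... | nothing = ≡.refl
      ... | just v  = lookup∘update′ (λ { ≡.refl → contradiction (injective zero (suc r) w ρ₀≡w p) λ () }) S false
    term : ∀ j → coeffOf (entry (M zero j) ⊗ det (λ r s → entry (minorE M j r s))) S ≈
                 N zero j * detF (minor N j)
    term j with ρ zero in ρ₀
    ... | nothing = inactive (inj₁ ρ₀) j
    ... | just w with lookup S w in w?S
    ...   | false = inactive (inj₂ (w , ρ₀ , w?S)) j
    ...   | true  = chosen w ρ₀ w?S j

lookup-⊤ : ∀ {n} (w : Fin n) → lookup (⊤ {n}) w ≡ true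
lookup-⊤ w = lookup-replicate w true

-- Read-once matrices with full top degree: one row per variable, and coefficients as scalar
-- determinants.

module ReadOnceDeterminant {c ℓ : Level} (F : Field c ℓ) (n m : ℕ)
  (M : Fin m → Fin m → Poly.Entry F n) (readOnce : Poly.ReadOnce F n M)
  (full : Poly.Full F n n (Poly.det F n (λ i j → Poly.entry F n (M i j)))) where

  open Poly F n
  open Determinant F
  open Expansion F n
  open Coefficients F n
  open LinearDependence F
  open import Relation.Binary.Reasoning.Setoid setoid
  open Counting

  full⊤ : ¬ detCoeff M ⊤ ≈ 0#
  full⊤ = full ⊤ (∣⊤∣≡n n)

  isVar? : ∀ (e : Entry) w → Dec (e ≡ inj₁ w)
  isVar? (inj₁ u) w = map′ (≡.cong inj₁) (λ { ≡.refl → ≡.refl }) (u ≟ w)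
  isVar? (inj₂ a) w = no λ ()

  -- If a variable were missing from M, the coefficient of the product of all variables would
  -- vanish.
  position : ∀ w → ∃ λ i → ∃ λ j → M i j ≡ inj₁ w
  position w with any? (λ i → any? λ j → isVar? (M i j) w)
  ... | yes found = found
  ... | no  none  = contradiction
    (detCoeff-absent M ⊤ w (lookup-⊤ w) λ i j eq → none (i , j , eq)) full⊤

  -- Read-once confines both variables to row i; if they were distinct, the coefficient of the
  -- product of all variables would vanish.
  same-row : ∀ {i j j′ v w} → M i j ≡ inj₁ v → M i j′ ≡ inj₁ w → v ≡ w
  same-row {i} {j} {j′} {v} {w} p q with v ≟ w
  ... | yes v≡w = v≡w
  ... | no  v≢w = contradiction
    (detCoeff-two-in-row M ⊤ i v≢w (lookup-⊤ v) (lookup-⊤ w)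
      (λ r s eq → proj₁ (readOnce r s i j v eq p))
      (λ r s eq → proj₁ (readOnce r s i j′ w eq q)))
    full⊤

  varInRow? : ∀ i → Dec (∃ λ w → ∃ λ j → M i j ≡ inj₁ w)
  varInRow? i = any? λ w → any? λ j → isVar? (M i j) w

  ρ : Fin m → Maybe (Fin n)
  ρ i = Maybe.map proj₁ (dec⇒maybe (varInRow? i))

  ρ-sound : ∀ i w → ρ i ≡ just w → ∃ λ j → M i j ≡ inj₁ w
  ρ-sound i w eq with varInRow? i
  ρ-sound i w ≡.refl | yes (_ , j , p) = j , p

  ρ-complete : ∀ i j w → M i j ≡ inj₁ w → ρ i ≡ just w
  ρ-complete i j w p with varInRow? i
  ... | yes (v , j′ , q) = ≡.cong just (same-row q p)
  ... | no  none         = contradiction (w , j , p) none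

  ρ-injective : ∀ i i′ w → ρ i ≡ just w → ρ i′ ≡ just w → i ≡ i′
  ρ-injective i i′ w p q with ρ-sound i w p | ρ-sound i′ w q
  ... | j , p′ | j′ , q′ = proj₁ (readOnce i j i′ j′ w p′ q′)

  R : Fin n → Fin m
  R w = proj₁ (position w)

  ρ-R : ∀ w → ρ (R w) ≡ just w
  ρ-R w = ρ-complete (R w) _ w (proj₂ (proj₂ (position w)))

  R-injective : ∀ {v w} → R v ≡ R w → v ≡ w
  R-injective {v} {w} eq = just-injective (≡.trans (≡.sym (ρ-R v)) (≡.trans (≡.cong ρ eq) (ρ-R w)))

  rows : Subset n → Matrix m
  rows S i j = select (active S (ρ i)) (M i j)

  detCoeff-rows : ∀ S → detCoeff M S ≈ detF (rows S)
  detCoeff-rows S = detCoeff-select M ρ S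
    (record { only = ρ-complete ; injective = ρ-injective })
    (λ w _ → R w , ρ-R w)

  N : Matrix m
  N = rows ⊤

  det-N≉0 : ¬ detF N ≈ 0#
  det-N≉0 eq = full⊤ (trans (detCoeff-rows ⊤) eq)

  constants : Matrix m
  constants i j = select false (M i j)

  rows-out : ∀ S w → lookup S w ≡ false → ∀ j → rows S (R w) j ≈ constants (R w) j
  rows-out S w w∉S j rewrite ρ-R w | w∉S = refl

  -- Rows without a variable are included: for them the hypothesis is vacuous, and both matrices use
  -- the constant row.
  rows-in : ∀ S i → (∀ w → i ≡ R w → lookup S w ≡ true) → ∀ j → rows S i j ≈ N i j
  rows-in S i within j with ρ i in eq
  ... | nothing = refl
  ... | just w rewrite within w (ρ-injective i (R w) w eq (ρ-R w)) | lookup-⊤ w = refl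

  -- The size is tracked by an addition, the form in which the emptiness hypotheses give the degree.
  remove-size : ∀ (S : Subset n) v k → lookup S v ≡ true → ∣ S ∣ ℕ.+ k ≡ n → ∣ S [ v ]≔ false ∣ ℕ.+ suc k ≡ n
  remove-size S v k v∈S eq = ≡.trans (ℕₚ.+-suc _ k) (≡.trans (≡.cong (ℕ._+ k) (∣remove∣ S v v∈S)) eq)

  degree-indicator : ∀ S → degree (indicator S) ≡ ∣ S ∣
  degree-indicator S = ≡.trans (≡.cong degree (indicator-bit S)) (go S)
    where
    go : ∀ {k} (S : Vec Bool k) → Vec.foldr (λ _ → ℕ) ℕ._+_ 0 (Vec.map bit S) ≡ ∣ S ∣
    go []          = ≡.refl
    go (true ∷ S)  = ≡.cong suc (go S)
    go (false ∷ S) = go S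

  -- The zero pattern of `A`, and a vanishing coefficient of degree k.

  module Sparse
    (empty₁ : ∀ k → k ℕ.+ 1 ≡ n → Empty k (det (λ i j → entry (M i j))))
    (empty₂ : ∀ k → k ℕ.+ 2 ≡ n → Empty k (det (λ i j → entry (M i j))))
    (a : Matrix m) (a-spans : ∀ i j → constants i j ≈ ∑[ k < m ] (a i k * N k j)) where

    A : Fin n → Fin n → Carrier
    A v w = a (R v) (R w)

    out-spans : ∀ S v → lookup S v ≡ false → ∀ j → rows S (R v) j ≈ ∑[ k < m ] (a (R v) k * N k j)
    out-spans S v v∉S j = trans (rows-out S v v∉S j) (a-spans (R v) j)

    -- When S misses only v, `rows S` differs from N in row `R v` alone, so its determinant is
    -- `A v v * detF N`. It is also a coefficient of degree n - 1.
    A-diagonal : ∀ v → A v v ≈ 0#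
    A-diagonal v = *-cancel-0 det-N≉0 (begin
      A v v * detF N
        ≈⟨ *-congˡ (det-cong λ r j → restore r j) ⟨
      A v v * detF (rows S [ R v ≔ N (R v) ])
        ≈⟨ det-combination (R v) (R v) (a (R v)) N (out-spans S v (lookup∘update v ⊤ false)) others ⟨
      detF (rows S)
        ≈⟨ detCoeff-rows S ⟨
      detCoeff M S
        ≈⟨ empty₁ ∣ S ∣ (remove-size ⊤ v 0 (lookup-⊤ v) (≡.trans (ℕₚ.+-identityʳ _) (∣⊤∣≡n n)))
             (indicator S) (degree-indicator S) ⟩
      0# ∎)
      where
      S = ⊤ [ v ]≔ false
      row-in : ∀ k → k ≢ R v → ∀ j → rows S k j ≈ N k j
      row-in k k≢Rv = rows-in S k λ w k≡Rw →
        ≡.trans (lookup∘update′ (λ (w≡v : w ≡ v) → k≢Rv (≡.trans k≡Rw (≡.cong R w≡v))) ⊤ false) (lookup-⊤ w)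
      restore : ∀ r j → (rows S [ R v ≔ N (R v) ]) r j ≈ N r j
      restore r j = trans (row-cong {B = N} row-in (λ _ → refl) r j) (row-self N (λ _ → refl) r j)
      others : ∀ k → k ≢ R v → a (R v) k ≈ 0# ⊎ (k ≢ R v × (∀ j → rows S k j ≈ N k j))
      others k k≢Rv = inj₂ (k≢Rv , row-in k k≢Rv)

    -- When S misses v and w, the zero diagonal lets row `R v` be traded for `A v w` times row `R w`
    -- of N, and then row `R w` for `A w v` times row `R v` of N. What remains is N with two rows
    -- exchanged, so its determinant is nonzero, yet the coefficient has degree n - 2.
    A-asymmetric : ∀ v w → v ≢ w → ¬ A v w ≈ 0# → ¬ A w v ≈ 0# → ⊥
    A-asymmetric v w v≢w Avw≉0 Awv≉0 = *-nonzero Avw≉0 (*-nonzero Awv≉0 det-Q″≉0) (begin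
      A v w * (A w v * detF Q″)
        ≈⟨ *-congˡ (det-combination (R w) (R v) (a (R w)) N
             (λ j → trans (row-≢ Q (R v) _ Rw≢Rv j) (out-spans S w w∉S j)) others′) ⟨
      A v w * detF Q′
        ≈⟨ det-combination (R v) (R w) (a (R v)) N (out-spans S v v∉S) others ⟨
      detF Q
        ≈⟨ detCoeff-rows S ⟨
      detCoeff M S
        ≈⟨ empty₂ ∣ S ∣ (remove-size (⊤ [ v ]≔ false) w 1
             (≡.trans (lookup∘update′ (v≢w ∘ ≡.sym) ⊤ false) (lookup-⊤ w))
             (remove-size ⊤ v 0 (lookup-⊤ v) (≡.trans (ℕₚ.+-identityʳ _) (∣⊤∣≡n n))))
             (indicator S) (degree-indicator S) ⟩
      0# ∎)
      where
      S = (⊤ [ v ]≔ false) [ w ]≔ false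
      v∉S : lookup S v ≡ false
      v∉S = ≡.trans (lookup∘update′ v≢w (⊤ [ v ]≔ false) false) (lookup∘update v ⊤ false)
      w∉S : lookup S w ≡ false
      w∉S = lookup∘update w (⊤ [ v ]≔ false) false
      Rw≢Rv : R w ≢ R v
      Rw≢Rv = v≢w ∘ ≡.sym ∘ R-injective
      Q Q′ Q″ : Matrix m
      Q  = rows S
      Q′ = Q [ R v ≔ N (R w) ]
      Q″ = Q′ [ R w ≔ N (R v) ]
      row-in : ∀ k → k ≢ R v → k ≢ R w → ∀ j → Q k j ≈ N k j
      row-in k k≢Rv k≢Rw = rows-in S k λ u k≡Ru →
        ≡.trans (lookup∘update′ (λ u≡w → k≢Rw (≡.trans k≡Ru (≡.cong R u≡w))) (⊤ [ v ]≔ false) false)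
          (≡.trans (lookup∘update′ (λ (u≡v : u ≡ v) → k≢Rv (≡.trans k≡Ru (≡.cong R u≡v))) ⊤ false) (lookup-⊤ u))
      others : ∀ k → k ≢ R w → a (R v) k ≈ 0# ⊎ (k ≢ R v × (∀ j → Q k j ≈ N k j))
      others k k≢Rw with k ≟ R v
      ... | yes ≡.refl = inj₁ (A-diagonal v)
      ... | no  k≢Rv   = inj₂ (k≢Rv , row-in k k≢Rv k≢Rw)
      others′ : ∀ k → k ≢ R v → a (R w) k ≈ 0# ⊎ (k ≢ R w × (∀ j → Q′ k j ≈ N k j))
      others′ k k≢Rv with k ≟ R w
      ... | yes ≡.refl = inj₁ (A-diagonal w)
      ... | no  k≢Rw   = inj₂ (k≢Rw , λ j → trans (row-≢ Q (R v) _ k≢Rv j) (row-in k k≢Rv k≢Rw j))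
      det-Q″≉0 : ¬ detF Q″ ≈ 0#
      det-Q″≉0 det≈0 = det-N≉0 (begin
        detF N            ≈⟨ +-identityʳ _ ⟨
        detF N + 0#       ≈⟨ +-congˡ det≈0 ⟨
        detF N + detF Q″  ≈⟨ det-swap (Rw≢Rv ∘ ≡.sym) (det-alternating (Rw≢Rv ∘ ≡.sym))
                               (λ r r≢Rv r≢Rw j → sym (trans (row-≢ Q′ (R w) _ r≢Rw j)
                                 (trans (row-≢ Q (R v) _ r≢Rv j) (row-in r r≢Rv r≢Rw j))))
                               (λ j → trans (row-≢ Q′ (R w) _ (Rw≢Rv ∘ ≡.sym) j) (row-≡ Q (R v) _ j))
                               (row-≡ Q′ (R w) _) ⟩
        0#                ∎)

    module _ (zero? : ∀ v w → Dec (A v w ≈ 0#)) where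

      E : Fin n → Fin n → Bool
      E v w = does (zero? v w)

      E-sound : ∀ {v w} → E v w ≡ true → A v w ≈ 0#
      E-sound {v} {w} eq with zero? v w
      ... | yes p = p

      E-complete : ∀ {v w} → A v w ≈ 0# → E v w ≡ true
      E-complete {v} {w} = dec-true (zero? v w)

      E-total : ∀ v w → v ≢ w → E v w ≡ true ⊎ E w v ≡ true
      E-total v w v≢w with zero? v w | zero? w v
      ... | yes _ | _     = inj₁ ≡.refl
      ... | no  _ | yes _ = inj₂ ≡.refl
      ... | no  p | no  q = contradiction q (A-asymmetric v w v≢w p)

      -- Row v of A[T] vanishes when T lies among the w with A v w = 0.
      not-full : ∀ k → (n ∸ 1) / 2 ≤ k → k < n → ¬ Full k (det (λ i j → entry (M i j)))
      not-full k half≤k k<n fullₖ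
        with large-neighbourhood E (ℕₚ.≤-trans (s≤s z≤n) k<n) (λ v → E-complete (A-diagonal v)) E-total
      ... | v , n<2d
        with subset-of-size-∋ (tabulate (E v)) v (n ∸ k)
               (≡.trans (lookup∘tabulate (E v) v) (E-complete (A-diagonal v)))
               (ℕₚ.m<n⇒0<n∸m k<n) (complement-size-≤ n k _ half≤k k<n n<2d)
      ... | T , ∣T∣≡n∸k , v∈T , T⊑E = fullₖ S ∣S∣≡k (begin
        detCoeff M S
          ≈⟨ detCoeff-rows S ⟩
        detF (rows S)
          ≈⟨ det-combination (R v) (R v) (a (R v)) N (out-spans S v (out v v∈T)) others ⟩
        A v v * detF (rows S [ R v ≔ N (R v) ])
          ≈⟨ *-congʳ (A-diagonal v) ⟩
        0# * detF (rows S [ R v ≔ N (R v) ])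
          ≈⟨ zeroˡ _ ⟩
        0# ∎)
        where
        S = ∁ T
        ∣S∣≡k : ∣ S ∣ ≡ k
        ∣S∣≡k = ≡.trans (∣∁p∣≡n∸∣p∣ T) (≡.trans (≡.cong (n ∸_) ∣T∣≡n∸k) (ℕₚ.m∸[m∸n]≡n (ℕₚ.<⇒≤ k<n)))
        out : ∀ w → lookup T w ≡ true → lookup S w ≡ false
        out w w∈T = ≡.trans (lookup-map w not T) (≡.cong not w∈T)
        -- The row of a variable in T has coefficient zero in the expansion of row `R v`, by the
        -- choice of T. Every other row, with or without a variable, coincides with that of N.
        others : ∀ i → i ≢ R v → a (R v) i ≈ 0# ⊎ (i ≢ R v × (∀ j → rows S i j ≈ N i j))
        others i i≢Rv with any? (λ w → (i ≟ R w) ×-dec (lookup T w Bool.≟ true))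
        ... | yes (w , ≡.refl , w∈T) = inj₁ (E-sound (≡.trans (≡.sym (lookup∘tabulate (E v) w)) (T⊑E w w∈T)))
        ... | no  none = inj₂ (i≢Rv , rows-in S i λ w i≡Rw →
          ≡.trans (lookup-map w not T) (≡.cong not (¬-not λ w∈T → none (w , i≡Rw , w∈T))))

-- Assembly of the argument under double negations.

open import Data.Nat using (_+_)

theorem6 : ∀ {c ℓ : Level} (F : Field c ℓ) (n m : ℕ)
    (M : Fin m → Fin m → Poly.Entry F n) →
    Poly.ReadOnce F n M →
    Poly.Full F n n (Poly.det F n (λ i j → Poly.entry F n (M i j))) →
    (∀ k → k + 1 ≡ n → Poly.Empty F n k (Poly.det F n (λ i j → Poly.entry F n (M i j)))) →
    (∀ k → k + 2 ≡ n → Poly.Empty F n k (Poly.det F n (λ i j → Poly.entry F n (M i j)))) →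
    ∀ k → (n ∸ 1) / 2 ≤ k → k < n →
    ¬ Poly.Full F n k (Poly.det F n (λ i j → Poly.entry F n (M i j)))
theorem6 F n m M readOnce full empty₁ empty₂ k half≤k k<n fullₖ =
  -- With fullness in degree k assumed the goal is empty. This permits extracting first the spanning
  -- coefficients of all constant rows, then a decision for every entry of `A` whether it is zero.
  ¬¬-∀ (λ i → rows-span N det-N≉0 (constants i)) λ spans →
  let open Sparse empty₁ empty₂ (proj₁ ∘ spans) (proj₂ ∘ spans) in
  ¬¬-∀ (λ v → ¬¬-∀ λ w → ¬¬-excluded-middle) λ zero? →
  not-full zero? k half≤k k<n fullₖ
  where
  open LinearDependence F
  open ReadOnceDeterminant F n m M readOnce full
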